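{- Fix $a\in\mathbb{Q}^\times$, let $E_a$ be the elliptic curve $Y^2=X^3+4X^2+16a^2$ over $\mathbb{Q}$ with point at infinity $\mathcal{O}$, and for $b\in\mathbb{Q}$ let $f_{b,a}(x)=x^3+bx+a$. There is a bijection between (1) rational points $Q\in E_a(\mathbb{Q})\setminus\{\mathcal{O}\}$ that can be written $Q=(X,Y)$ with $X\neq0$ and $Y\neq0$, and (2) ordered triples $(b,x_1,x_2)\in\mathbb{Q}^3$ such that $x_1\neq x_2$, $f_{b,a}(x_1)=x_2$ and $f_{b,a}(x_2)=x_1$. The forward map (from (1) to (2)) is $$b=-\frac{X}{4}-2-\frac{16a^2}{X^2},\qquad x_1=\frac{ -4a-Y}{2X},\qquad x_2=\frac{ -4a+Y}{2X},$$ and the inverse map is $$(b,x_1,x_2)\longmapsto (X,Y)=\left(-\frac{4a}{x_1+x_2},\ \frac{4a(x_1-x_2)}{x_1+x_2}\right).$$ -}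

module Defs where

open import Agda.Builtin.FromNat using (Number; fromNat)
open import Data.Integer.Base using (+[1+_]; -[1+_])
open import Data.Product.Base using (_×_; _,_)
open import Data.Rational.Base
open import Data.Rational.Properties
open import Data.Unit.Base using (tt)
open import Relation.Binary.PropositionalEquality using (_≡_; _≢_; refl; sym; subst)
open import Algebra.Definitions.RawSemiring +-*-rawSemiring using (_^_)
open import Algebra.Apartness.Properties.HeytingCommutativeRing heytingCommutativeRing using (x#0y#0→xy#0)
import Data.Nat.Literals as ℕ-Literals
import Data.Rational.Literals as ℚ-Literals

-- Numerals below are elements of ℚ except in exponents, which are in ℕ.
private instance
  numberℕ = ℕ-Literals.number
  numberℚ = ℚ-Literals.number

------------------------------------------------------------------------
-- Elliptic curves over ℚ

-- The discriminant of y² + a₁xy + a₃y = x³ + a₂x² + a₄x + a₆, by the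
-- usual formula in b₂, b₄, b₆, b₈.
discriminant : (a₁ a₂ a₃ a₄ a₆ : ℚ) → ℚ
discriminant a₁ a₂ a₃ a₄ a₆ =
  - (b₂ ^ 2) * b₈ - 8 * b₄ ^ 3 - 27 * b₆ ^ 2 + 9 * b₂ * b₄ * b₆
  where
  b₂ = a₁ ^ 2 + 4 * a₂
  b₄ = 2 * a₄ + a₁ * a₃
  b₆ = a₃ ^ 2 + 4 * a₆
  b₈ = a₁ ^ 2 * a₆ + 4 * a₂ * a₆ - a₁ * a₃ * a₄ + a₂ * a₃ ^ 2 - a₄ ^ 2

record EllipticCurve : Set where
  field
    a₁ a₂ a₃ a₄ a₆ : ℚ
    .nonsingular   : NonZero (discriminant a₁ a₂ a₃ a₄ a₆)

OnCurve : EllipticCurve → ℚ → ℚ → Set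
OnCurve E x y =
  y ^ 2 + a₁ * x * y + a₃ * y ≡ x ^ 3 + a₂ * x ^ 2 + a₄ * x + a₆
  where open EllipticCurve E

-- E(ℚ).  Equality in ℚ is decidable, so any two proofs of OnCurve E x y
-- are equal and a point is determined by its coordinates.
data Point (E : EllipticCurve) : Set where
  𝒪      : Point E
  affine : (x y : ℚ) → OnCurve E x y → Point E

------------------------------------------------------------------------
-- The curve Y² = X³ + 4X² + 16a²

square-pos : ∀ p .{{_ : NonZero p}} → Positive (p ^ 2)
square-pos p@(mkℚ +[1+ _ ] _ _) =
  subst (λ q → Positive (p * q)) (sym (*-identityʳ p)) (pos*pos⇒pos p p)
square-pos p@(mkℚ -[1+ _ ] _ _) =
  subst (λ q → Positive (p * q)) (sym (*-identityʳ p)) (neg*neg⇒pos p p)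

discriminant≢0 : ∀ {a} → a ≢ 0 → NonZero (discriminant 0 4 0 0 (16 * a ^ 2))
discriminant≢0 {a} a≢0 = neg⇒nonZero (- 256 * b₈ - 0 - 27 * b₆ ^ 2 + 0 * b₆) {{Δ-neg}}
  where
  d  = 16 * a ^ 2
  b₆ = 0 + 4 * d
  b₈ = 0 * d + 16 * d - 0 + 0 - 0
  d-pos : Positive d
  d-pos = pos*pos⇒pos 16 (a ^ 2) {{square-pos a {{≢-nonZero a≢0}}}}
  b₆-pos : Positive b₆
  b₆-pos = nonNeg+pos⇒pos 0 (4 * d) {{pos*pos⇒pos 4 d {{d-pos}}}}
  b₈-pos : Positive b₈
  b₈-pos =
    pos+nonNeg⇒pos (0 * d + 16 * d - 0 + 0)
      {{pos+nonNeg⇒pos (0 * d + 16 * d - 0)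
        {{pos+nonNeg⇒pos (0 * d + 16 * d)
          {{nonNeg+pos⇒pos (0 * d) {{nonNeg*nonNeg⇒nonNeg 0 d {{pos⇒nonNeg d {{d-pos}}}}}}
            (16 * d) {{pos*pos⇒pos 16 d {{d-pos}}}}}} 0}} 0}} 0
  27b₆²-pos : Positive (27 * b₆ ^ 2)
  27b₆²-pos = pos*pos⇒pos 27 (b₆ ^ 2) {{square-pos b₆ {{pos⇒nonZero b₆ {{b₆-pos}}}}}}
  Δ-neg : Negative (- 256 * b₈ - 0 - 27 * b₆ ^ 2 + 0 * b₆)
  Δ-neg =
    neg+nonPos⇒neg (- 256 * b₈ - 0 - 27 * b₆ ^ 2)
      {{neg+neg⇒neg (- 256 * b₈ - 0)
        {{neg+nonPos⇒neg (- 256 * b₈) {{neg*pos⇒neg (- 256) b₈ {{b₈-pos}}}} 0}}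
        (- (27 * b₆ ^ 2)) {{neg-pos {27 * b₆ ^ 2} 27b₆²-pos}}}}
      (0 * b₆) {{subst NonPositive (sym (*-zeroˡ b₆)) _}}

E : (a : ℚ) → a ≢ 0 → EllipticCurve
E a a≢0 = record
  { a₁ = 0; a₂ = 4; a₃ = 0; a₄ = 0; a₆ = 16 * a ^ 2
  ; nonsingular = discriminant≢0 a≢0
  }

------------------------------------------------------------------------
-- The two sets in bijection

-- Every field other than Q is determined by Q up to _≡_, so _≡_ on this
-- type is equality of the points Q; likewise for TwoCycle and (b , x₁ , x₂).
record PointWithNonzeroCoordinates (a : ℚ) (a≢0 : a ≢ 0) : Set where
  field
    Q       : Point (E a a≢0)
    Q≢𝒪     : Q ≢ 𝒪
    X Y     : ℚ
    onCurve : OnCurve (E a a≢0) X Y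
    Q≡XY    : Q ≡ affine X Y onCurve
    X≢0     : X ≢ 0
    Y≢0     : Y ≢ 0

f : (b a : ℚ) → ℚ → ℚ
f b a x = x ^ 3 + b * x + a

record TwoCycle (a : ℚ) : Set where
  field
    b x₁ x₂ : ℚ
    x₁≢x₂   : x₁ ≢ x₂
    fx₁≡x₂  : f b a x₁ ≡ x₂
    fx₂≡x₁  : f b a x₂ ≡ x₁

------------------------------------------------------------------------
-- The explicit formulas

-- (X , Y) ↦ (b , x₁ , x₂)
forward : (a X Y : ℚ) → X ≢ 0 → ℚ × ℚ × ℚ
forward a X Y X≢0 =
    - (X ÷ 4) - 2 - ((16 * a ^ 2) ÷ (X ^ 2)) {{≢-nonZero X²≢0}}
  , ((- (4 * a) - Y) ÷ (2 * X)) {{≢-nonZero 2X≢0}}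
  , ((- (4 * a) + Y) ÷ (2 * X)) {{≢-nonZero 2X≢0}}
  where
  X²≢0 : X ^ 2 ≢ 0
  X²≢0 = x#0y#0→xy#0 X≢0 (x#0y#0→xy#0 X≢0 1≢0)
  2X≢0 : 2 * X ≢ 0
  2X≢0 = x#0y#0→xy#0 {2} (λ ()) X≢0

-- (b , x₁ , x₂) ↦ (X , Y)
backward : (a x₁ x₂ : ℚ) → x₁ + x₂ ≢ 0 → ℚ × ℚ
backward a x₁ x₂ x₁+x₂≢0 =
    - (((4 * a) ÷ (x₁ + x₂)) {{≢-nonZero x₁+x₂≢0}})
  , ((4 * a * (x₁ - x₂)) ÷ (x₁ + x₂)) {{≢-nonZero x₁+x₂≢0}}

{-# OPTIONS --safe #-}

-- A point (X , Y) and a triple (b , x₁ , x₂) correspond when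
--   2X x₁ = −4a − Y,  2X x₂ = −4a + Y,  4X² b = −X³ − 8X² − 64a².
-- These division-free relations determine the triple from the point when
-- X ≠ 0, and the point from the triple because s = x₁ + x₂ satisfies
-- X s = −4a ≠ 0 and Y = X (x₂ − x₁).  Both explicit maps satisfy them, so
-- the maps are mutually inverse.  For a 2-cycle, dividing f x₁ − f x₂ = x₂ − x₁
-- by x₁ − x₂ and adding the two cycle equations gives
--   x₁² + x₁x₂ + x₂² + b + 1 = 0  and  a = s (s² + b + 2),
-- whence s x₁x₂ = a − s, and Y² = X² (s² − 4 x₁x₂) becomes the curve equation.

module Submission where

open import Algebra.Apartness.Properties.HeytingCommutativeRing
  using (x#0y#0→xy#0)
open import Algebra.Properties.Group using (x∙y⁻¹≈ε⇒x≈y; ⁻¹-involutive)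
open import Axiom.UniquenessOfIdentityProofs.WithK using (uip)
open import Data.Product.Base using (Σ-syntax; _×_; _,_; proj₁; proj₂)
open import Data.Rational.Base
  using (ℚ; 0ℚ; ½; _+_; _*_; _-_; -_; _÷_; 1/_; NonZero; ≢-nonZero)
open import Data.Rational.Properties
  using (heytingCommutativeRing; +-*-rawSemiring; +-0-group; +-inverseʳ; *-assoc; *-comm;
         *-identityˡ; *-identityʳ; *-inverseˡ; *-inverseʳ; *-zeroˡ; *-zeroʳ;
         neg-distribˡ-*)
open import Algebra.Definitions.RawSemiring +-*-rawSemiring using (_^_)
open import Data.Rational.Solver using (module +-*-Solver)
open import Data.Unit.Base using (tt)
open import Function.Bundles using (_↔_; Inverse; mk↔ₛ′)
open import Relation.Binary.PropositionalEquality
  using (_≡_; _≢_; refl; sym; trans; cong; module ≡-Reasoning)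
import Data.Nat.Literals as ℕ-Literals
import Data.Rational.Literals as ℚ-Literals
open import Defs
open +-*-Solver

-- The type of solve computes only once its arity is a numeral in ℕ, which an
-- overloaded literal becomes too late: hence these precede the import of fromNat.
private
  solve₂ = solve 2
  solve₃ = solve 3
  solve₄ = solve 4
  solve₅ = solve 5
  solve₆ = solve 6

open import Agda.Builtin.FromNat using (fromNat)

private instance
  numberℕ = ℕ-Literals.number
  numberℚ = ℚ-Literals.number

-- Cancellation and division in ℚ.

*-≢0 : ∀ {p q} → p ≢ 0 → q ≢ 0 → p * q ≢ 0
*-≢0 = x#0y#0→xy#0 heytingCommutativeRing

^2-≢0 : ∀ {p} → p ≢ 0 → p ^ 2 ≢ 0
^2-≢0 p≢0 = *-≢0 p≢0 (*-≢0 p≢0 λ ())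

*-cancelˡ-≢0 : ∀ {r p q} → r ≢ 0 → r * p ≡ r * q → p ≡ q
*-cancelˡ-≢0 {r} {p} {q} r≢0 rp≡rq = begin
  p              ≡⟨ *-identityˡ p ⟨
  1 * p          ≡⟨ cong (_* p) (*-inverseˡ r) ⟨
  1/ r * r * p   ≡⟨ *-assoc (1/ r) r p ⟩
  1/ r * (r * p) ≡⟨ cong (1/ r *_) rp≡rq ⟩
  1/ r * (r * q) ≡⟨ *-assoc (1/ r) r q ⟨
  1/ r * r * q   ≡⟨ cong (_* q) (*-inverseˡ r) ⟩
  1 * q          ≡⟨ *-identityˡ q ⟩
  q              ∎
  where
  open ≡-Reasoning
  instance _ = ≢-nonZero r≢0

*-÷-cancel : ∀ q p .{{_ : NonZero q}} → q * (p ÷ q) ≡ p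
*-÷-cancel q p = begin
  q * (p * 1/ q) ≡⟨ solve₃ (λ q p r → q :* (p :* r) := p :* (q :* r)) refl q p (1/ q) ⟩
  p * (q * 1/ q) ≡⟨ cong (p *_) (*-inverseʳ q) ⟩
  p * 1          ≡⟨ *-identityʳ p ⟩
  p              ∎
  where open ≡-Reasoning

-- Nested uses of this lemma present A − B as a linear combination of
-- hypotheses L − R = 0, which leaves a polynomial identity to the ring solver.
modulo : ∀ c {A B L R} → L ≡ R → A ≡ B + c * (L - R) → A ≡ B
modulo c {B = B} {L = L} refl A≡ =
  trans A≡ (solve₃ (λ B c L → B :+ c :* (L :- L) := B) refl B c L)

-- The division-free correspondence.

record Corresponds (a X Y b x₁ x₂ : ℚ) : Set where
  field
    2Xx₁ : 2 * X * x₁ ≡ - (4 * a) - Y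
    2Xx₂ : 2 * X * x₂ ≡ - (4 * a) + Y
    4X²b : 4 * X ^ 2 * b ≡ - X ^ 3 - 8 * X ^ 2 - 64 * a ^ 2

  Xs : X * (x₁ + x₂) ≡ - (4 * a)
  Xs = modulo ½ 2Xx₁ (modulo ½ 2Xx₂
    (solve₅ (λ a X Y x₁ x₂ →
        X :* (x₁ :+ x₂) :=
        :- (con 4 :* a)
          :+ con ½ :* (con 2 :* X :* x₁ :- (:- (con 4 :* a) :- Y))
          :+ con ½ :* (con 2 :* X :* x₂ :- (:- (con 4 :* a) :+ Y)))
      refl a X Y x₁ x₂))

  Y≡Xd : Y ≡ X * (x₂ - x₁)
  Y≡Xd = modulo ½ 2Xx₁ (modulo (- ½) 2Xx₂
    (solve₅ (λ a X Y x₁ x₂ →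
        Y :=
        X :* (x₂ :- x₁)
          :+ con ½ :* (con 2 :* X :* x₁ :- (:- (con 4 :* a) :- Y))
          :+ con (- ½) :* (con 2 :* X :* x₂ :- (:- (con 4 :* a) :+ Y)))
      refl a X Y x₁ x₂))

-- The product is nonzero because a is. One component shows that a cycle gives X ≠ 0; the other
-- allows s to be cancelled when X is recovered from a triple.
factors≢0 : ∀ {a X s} → a ≢ 0 → X * s ≡ - (4 * a) → X ≢ 0 × s ≢ 0
factors≢0 {a} {X} {s} a≢0 Xs =
    (λ X≡0 → Xs≢0 (trans (cong (_* s) X≡0) (*-zeroˡ s)))
  , (λ s≡0 → Xs≢0 (trans (cong (X *_) s≡0) (*-zeroʳ X)))
  where
  Xs≢0 : X * s ≢ 0
  Xs≢0 Xs≡0 = *-≢0 { - 4} (λ ()) a≢0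
    (trans (sym (neg-distribˡ-* 4 a)) (trans (sym Xs) Xs≡0))

corresponds-unique-cycle : ∀ {a X Y b b′ x₁ x₁′ x₂ x₂′} → X ≢ 0 →
  Corresponds a X Y b x₁ x₂ → Corresponds a X Y b′ x₁′ x₂′ →
  b ≡ b′ × x₁ ≡ x₁′ × x₂ ≡ x₂′
corresponds-unique-cycle X≢0 c c′ =
    *-cancelˡ-≢0 (*-≢0 {4} (λ ()) (^2-≢0 X≢0)) (trans C.4X²b (sym C′.4X²b))
  , *-cancelˡ-≢0 2X≢0 (trans C.2Xx₁ (sym C′.2Xx₁))
  , *-cancelˡ-≢0 2X≢0 (trans C.2Xx₂ (sym C′.2Xx₂))
  where
  module C  = Corresponds c
  module C′ = Corresponds c′
  2X≢0 = *-≢0 {2} (λ ()) X≢0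

corresponds-unique-point : ∀ {a X X′ Y Y′ b b′ x₁ x₂} → a ≢ 0 →
  Corresponds a X Y b x₁ x₂ → Corresponds a X′ Y′ b′ x₁ x₂ →
  X ≡ X′ × Y ≡ Y′
corresponds-unique-point {X = X} {X′} {x₁ = x₁} {x₂} a≢0 c c′ =
  X≡X′ , trans C.Y≡Xd (trans (cong (_* (x₂ - x₁)) X≡X′) (sym C′.Y≡Xd))
  where
  module C  = Corresponds c
  module C′ = Corresponds c′
  X≡X′ : X ≡ X′
  X≡X′ = *-cancelˡ-≢0 (proj₂ (factors≢0 {X = X} a≢0 C.Xs))
    (trans (*-comm (x₁ + x₂) X) (trans C.Xs (trans (sym C′.Xs) (*-comm X′ (x₁ + x₂)))))

-- From points to 2-cycles.

forward-corresponds : ∀ a X Y X≢0 →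
  let b , x₁ , x₂ = forward a X Y X≢0 in Corresponds a X Y b x₁ x₂
forward-corresponds a X Y X≢0 = record
  { 2Xx₁ = *-÷-cancel (2 * X) (- (4 * a) - Y) {{2X}}
  ; 2Xx₂ = *-÷-cancel (2 * X) (- (4 * a) + Y) {{2X}}
  ; 4X²b = modulo (- (X ^ 2)) (*-÷-cancel 4 X)
      (modulo (- 4) (*-÷-cancel (X ^ 2) (16 * a ^ 2) {{X²}})
        -- The quotients enter as atoms d and q, known only through 4d = X and X²q = 16a².
        (solve₄ (λ a X d q →
            con 4 :* X :^ 2 :* (:- d :- con 2 :- q) :=
            (:- (X :^ 3) :- con 8 :* X :^ 2 :- con 64 :* a :^ 2)
              :+ (:- (X :^ 2)) :* (con 4 :* d :- X)
              :+ con (- 4) :* (X :^ 2 :* q :- con 16 :* a :^ 2))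
          refl a X (X ÷ 4) ((16 * a ^ 2 ÷ X ^ 2) {{X²}})))
  }
  where
  2X = ≢-nonZero (*-≢0 {2} (λ ()) X≢0)
  X² = ≢-nonZero (^2-≢0 X≢0)

-- Substituting 2X x₁, 2X x₂, 4X² b in 8X³ (f x₁ − x₂) leaves
-- −(12a + Y) times the curve equation.
corresponds⇒f-step : ∀ {a a≢0 X Y b x₁ x₂} → X ≢ 0 → OnCurve (E a a≢0) X Y →
  2 * X * x₁ ≡ - (4 * a) - Y → 2 * X * x₂ ≡ - (4 * a) + Y →
  4 * X ^ 2 * b ≡ - X ^ 3 - 8 * X ^ 2 - 64 * a ^ 2 →
  f b a x₁ ≡ x₂
corresponds⇒f-step {a} {a≢0} {X} {Y} {b} {x₁} {x₂} X≢0 curve h₁ h₂ h₃ =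
  *-cancelˡ-≢0 (*-≢0 2X≢0 (*-≢0 2X≢0 2X≢0))
    -- Replacing U by N in U³ + 4X²b U changes it by U - N times this factor.
    (modulo (N * N + N * U + U * U + 4 * X ^ 2 * b) h₁
    (modulo (- (4 * X ^ 2)) h₂
    (modulo N h₃
    (modulo (- (12 * a + Y)) curve
    (solve₆ (λ a X Y b x₁ x₂ →
        let M = con 2 :* X
            U = M :* x₁
            N = :- (con 4 :* a) :- Y
        in
        M :* (M :* M) :* (x₁ :^ 3 :+ b :* x₁ :+ a) :=
        M :* (M :* M) :* x₂
          :+ (N :* N :+ N :* U :+ U :* U :+ con 4 :* X :^ 2 :* b) :* (U :- N)
          :+ (:- (con 4 :* X :^ 2)) :* (M :* x₂ :- (:- (con 4 :* a) :+ Y))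
          :+ N :* (con 4 :* X :^ 2 :* b :- (:- (X :^ 3) :- con 8 :* X :^ 2 :- con 64 :* a :^ 2))
          :+ (:- (con 12 :* a :+ Y)) :*
               ((Y :^ 2 :+ con 0 :* X :* Y :+ con 0 :* Y) :-
                (X :^ 3 :+ con 4 :* X :^ 2 :+ con 0 :* X :+ con 16 :* a :^ 2)))
      refl a X Y b x₁ x₂)))))
  where
  2X≢0 = *-≢0 {2} (λ ()) X≢0
  U = 2 * X * x₁
  N = - (4 * a) - Y

corresponds⇒x₁≢x₂ : ∀ {a X Y b x₁ x₂} → Corresponds a X Y b x₁ x₂ → Y ≢ 0 → x₁ ≢ x₂
corresponds⇒x₁≢x₂ {X = X} {x₁ = x} c Y≢0 refl = Y≢0
  (trans (Corresponds.Y≡Xd c) (trans (cong (X *_) (+-inverseʳ x)) (*-zeroʳ X)))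

pointToCycle : ∀ {a a≢0} → PointWithNonzeroCoordinates a a≢0 → TwoCycle a
pointToCycle {a} {a≢0} P = record
  { b      = proj₁ (forward a X Y X≢0)
  ; x₁     = proj₁ (proj₂ (forward a X Y X≢0))
  ; x₂     = proj₂ (proj₂ (forward a X Y X≢0))
  ; x₁≢x₂  = corresponds⇒x₁≢x₂ c Y≢0
  ; fx₁≡x₂ = corresponds⇒f-step {a≢0 = a≢0} X≢0 onCurve 2Xx₁ 2Xx₂ 4X²b
  -- The reflection Y ↦ -Y preserves the curve and exchanges the relations for x₁ and x₂.
  ; fx₂≡x₁ = corresponds⇒f-step {a≢0 = a≢0} X≢0 onCurve⁻
      (trans 2Xx₂ (cong (- (4 * a) +_) (sym (⁻¹-involutive +-0-group Y))))
      2Xx₁ 4X²b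
  }
  where
  open PointWithNonzeroCoordinates P
  c = forward-corresponds a X Y X≢0
  open Corresponds c
  onCurve⁻ : OnCurve (E a a≢0) X (- Y)
  onCurve⁻ = trans
    (solve₂ (λ X Y → (:- Y) :^ 2 :+ con 0 :* X :* (:- Y) :+ con 0 :* (:- Y)
                   := Y :^ 2 :+ con 0 :* X :* Y :+ con 0 :* Y) refl X Y)
    onCurve

-- From 2-cycles to points.

module FromCycle {a} (a≢0 : a ≢ 0) (t : TwoCycle a) where
  open TwoCycle t

  s = x₁ + x₂

  -- The chord of the cubic through (x₁ , x₂) and (x₂ , x₁) has slope -1.
  slope : x₁ ^ 2 + x₁ * x₂ + x₂ ^ 2 + b + 1 ≡ 0
  slope = *-cancelˡ-≢0 {x₁ - x₂} (λ d≡0 → x₁≢x₂ (x∙y⁻¹≈ε⇒x≈y +-0-group x₁ x₂ d≡0))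
    (modulo (- 1) fx₂≡x₁ (modulo 1 fx₁≡x₂
      (solve₄ (λ a b x₁ x₂ →
          (x₁ :- x₂) :* (x₁ :^ 2 :+ x₁ :* x₂ :+ x₂ :^ 2 :+ b :+ con 1) :=
          (x₁ :- x₂) :* con 0
            :+ con (- 1) :* ((x₂ :^ 3 :+ b :* x₂ :+ a) :- x₁)
            :+ con 1 :* ((x₁ :^ 3 :+ b :* x₁ :+ a) :- x₂))
        refl a b x₁ x₂)))

  a≡ : a ≡ s * (s ^ 2 + b + 2)
  -- Half the sum of the cycle equations contains -(3/2) s x₁x₂, from x₁³ + x₂³ = s³ - 3s x₁x₂; this
  -- multiple of `slope` cancels it.
  a≡ = modulo (- (1 + ½) * s) slope (modulo ½ fx₂≡x₁ (modulo ½ fx₁≡x₂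
      (solve₄ (λ a b x₁ x₂ →
          let s = x₁ :+ x₂ in
          a :=
          s :* (s :^ 2 :+ b :+ con 2)
            :+ con (- (1 + ½)) :* s :*
                 ((x₁ :^ 2 :+ x₁ :* x₂ :+ x₂ :^ 2 :+ b :+ con 1) :- con 0)
            :+ con ½ :* ((x₂ :^ 3 :+ b :* x₂ :+ a) :- x₁)
            :+ con ½ :* ((x₁ :^ 3 :+ b :* x₁ :+ a) :- x₂))
        refl a b x₁ x₂)))

  -- By `a≡`, s is a factor of a. This justifies the denominator in `backward`.
  s≢0 : s ≢ 0
  s≢0 s≡0 = a≢0 (trans a≡ (trans (cong (_* (s ^ 2 + b + 2)) s≡0) (*-zeroˡ (s ^ 2 + b + 2))))

  -- By `slope`, x₁x₂ = s² + b + 1; multiplying by s and using `a≡` eliminates b, which is absent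
  -- from the curve equation.
  s*x₁x₂ : s * (x₁ * x₂) ≡ a - s
  s*x₁x₂ = modulo (- s) slope (modulo (- 1) a≡
      (solve₄ (λ a b x₁ x₂ →
          let s = x₁ :+ x₂ in
          s :* (x₁ :* x₂) :=
          (a :- s)
            :+ (:- s) :* ((x₁ :^ 2 :+ x₁ :* x₂ :+ x₂ :^ 2 :+ b :+ con 1) :- con 0)
            :+ con (- 1) :* (a :- s :* (s :^ 2 :+ b :+ con 2)))
        refl a b x₁ x₂))

  X = proj₁ (backward a x₁ x₂ s≢0)
  Y = proj₂ (backward a x₁ x₂ s≢0)

  private instance _ = ≢-nonZero s≢0

  -- From here on, the identities use the formulas for X and Y only through `Xs` and `sY`.
  Xs : X * s ≡ - (4 * a)
  Xs = modulo (- 1) (*-÷-cancel s (4 * a))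
    (solve₃ (λ a s q → (:- q) :* s := (:- (con 4 :* a)) :+ con (- 1) :* (s :* q :- con 4 :* a))
      refl a s (4 * a ÷ s))

  sY : s * Y ≡ 4 * a * (x₁ - x₂)
  sY = *-÷-cancel s (4 * a * (x₁ - x₂))

  corresponds : Corresponds a X Y b x₁ x₂
  corresponds = record
    { 2Xx₁ = *-cancelˡ-≢0 s≢0 (modulo 1 sY (modulo (2 * x₁) Xs
        (solve₅ (λ a X Y x₁ x₂ →
            let s = x₁ :+ x₂ in
            s :* (con 2 :* X :* x₁) :=
            s :* (:- (con 4 :* a) :- Y)
              :+ con 1 :* (s :* Y :- con 4 :* a :* (x₁ :- x₂))
              :+ con 2 :* x₁ :* (X :* s :- :- (con 4 :* a)))
          refl a X Y x₁ x₂)))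
    ; 2Xx₂ = *-cancelˡ-≢0 s≢0 (modulo (- 1) sY (modulo (2 * x₂) Xs
        (solve₅ (λ a X Y x₁ x₂ →
            let s = x₁ :+ x₂ in
            s :* (con 2 :* X :* x₂) :=
            s :* (:- (con 4 :* a) :+ Y)
              :+ con (- 1) :* (s :* Y :- con 4 :* a :* (x₁ :- x₂))
              :+ con 2 :* x₂ :* (X :* s :- :- (con 4 :* a)))
          refl a X Y x₁ x₂)))
    ; 4X²b = *-cancelˡ-≢0 s≢0
        -- After `a≡`, what remains is X² (Xs + 4a) - 4s (X²s² - 16a²), a multiple of Xs + 4a.
        (modulo (- (4 * X ^ 2)) a≡ (modulo (X ^ 2 - 4 * s * (X * s - 4 * a)) Xs
          (solve₄ (λ a X b s →
              s :* (con 4 :* X :^ 2 :* b) :=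
              s :* (:- (X :^ 3) :- con 8 :* X :^ 2 :- con 64 :* a :^ 2)
                :+ (:- (con 4 :* X :^ 2)) :* (a :- s :* (s :^ 2 :+ b :+ con 2))
                :+ (X :^ 2 :- con 4 :* s :* (X :* s :- con 4 :* a)) :* (X :* s :- :- (con 4 :* a)))
            refl a X b s)))
    }
  open Corresponds corresponds using (Y≡Xd)

  onCurve : OnCurve (E a a≢0) X Y
  -- The factor s makes `s*x₁x₂` applicable; there remains s (X²s² - 16a²) - X² (Xs + 4a), again a
  -- multiple of Xs + 4a.
  onCurve = *-cancelˡ-≢0 s≢0
    (modulo (- (4 * X ^ 2)) s*x₁x₂
    (modulo (s * (X * s - 4 * a) - X ^ 2) Xs
    (modulo (s * (Y + X * (x₂ - x₁))) Y≡Xd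
    (solve₅ (λ a X Y x₁ x₂ →
        let s = x₁ :+ x₂ in
        s :* (Y :^ 2 :+ con 0 :* X :* Y :+ con 0 :* Y) :=
        s :* (X :^ 3 :+ con 4 :* X :^ 2 :+ con 0 :* X :+ con 16 :* a :^ 2)
          :+ (:- (con 4 :* X :^ 2)) :* (s :* (x₁ :* x₂) :- (a :- s))
          :+ (s :* (X :* s :- con 4 :* a) :- X :^ 2) :* (X :* s :- :- (con 4 :* a))
          :+ s :* (Y :+ X :* (x₂ :- x₁)) :* (Y :- X :* (x₂ :- x₁)))
      refl a X Y x₁ x₂))))

  X≢0 : X ≢ 0
  X≢0 = proj₁ (factors≢0 {s = s} a≢0 Xs)

  Y≢0 : Y ≢ 0
  Y≢0 Y≡0 = *-≢0 {X} {x₂ - x₁} X≢0 (λ d≡0 → x₁≢x₂ (sym (x∙y⁻¹≈ε⇒x≈y +-0-group x₂ x₁ d≡0)))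
    (trans (sym Y≡Xd) Y≡0)

  point : PointWithNonzeroCoordinates a a≢0
  point = record
    { Q = affine X Y onCurve ; Q≢𝒪 = λ () ; X = X ; Y = Y ; onCurve = onCurve
    ; Q≡XY = refl ; X≢0 = X≢0 ; Y≢0 = Y≢0 }

-- Equality in the two sets, and the bijection.

point-≡ : ∀ {a a≢0} {P P′ : PointWithNonzeroCoordinates a a≢0} →
  let open PointWithNonzeroCoordinates in X P ≡ X P′ × Y P ≡ Y P′ → P ≡ P′
point-≡ {P = record { onCurve = c ; Q≡XY = refl }}
        {P′ = record { onCurve = c′ ; Q≡XY = refl }} (refl , refl)
  -- Proofs of inequalities agree definitionally, so only the equation needs `uip`.
  with refl ← uip c c′ = refl

cycle-≡ : ∀ {a} {t t′ : TwoCycle a} →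
  let open TwoCycle in b t ≡ b t′ × x₁ t ≡ x₁ t′ × x₂ t ≡ x₂ t′ → t ≡ t′
cycle-≡ {t = record { fx₁≡x₂ = p ; fx₂≡x₁ = q }}
        {t′ = record { fx₁≡x₂ = p′ ; fx₂≡x₁ = q′ }} (refl , refl , refl)
  with refl ← uip p p′ | refl ← uip q q′ = refl

theorem3p1 :
    (a : ℚ) (a≢0 : a ≢ 0ℚ) →
    Σ[ φ ∈ PointWithNonzeroCoordinates a a≢0 ↔ TwoCycle a ]
      ((P : PointWithNonzeroCoordinates a a≢0) →
        let open PointWithNonzeroCoordinates P
            open TwoCycle (Inverse.to φ P)
        in (b , x₁ , x₂) ≡ forward a X Y X≢0)
      ×
      ((t : TwoCycle a) →
        let open TwoCycle t
            open PointWithNonzeroCoordinates (Inverse.from φ t)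
        in Σ[ x₁+x₂≢0 ∈ x₁ + x₂ ≢ 0ℚ ]
             (X , Y) ≡ backward a x₁ x₂ x₁+x₂≢0)
theorem3p1 a a≢0 =
    mk↔ₛ′ pointToCycle (FromCycle.point a≢0) to∘from from∘to
  , (λ P → refl)
  , (λ t → FromCycle.s≢0 a≢0 t , refl)
  where
  to∘from : ∀ t → pointToCycle (FromCycle.point a≢0 t) ≡ t
  -- Both triples correspond to the point built from t.
  to∘from t = cycle-≡ (corresponds-unique-cycle X≢0
      (forward-corresponds a X Y X≢0) corresponds)
    where open FromCycle a≢0 t

  from∘to : ∀ P → FromCycle.point a≢0 (pointToCycle P) ≡ P
  from∘to P = point-≡ (corresponds-unique-point a≢0
      (FromCycle.corresponds a≢0 (pointToCycle P)) (forward-corresponds a X Y X≢0))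
    where open PointWithNonzeroCoordinates P
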